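{- Let $n$ and $m\ge 1$ be two integers. If $2m+2\le n\le 3m$ and $(n-2m)\mid m$, then $$rsat(n,(m+1)K_2)=\frac{nm}{n-2m};$$ otherwise, $rsat(n,(m+1)K_2)$ does not exist.
   Context: All graphs are finite, undirected and simple. $(m+1)K_2$ denotes a matching of size $m+1$, i.e. $m+1$ pairwise vertex-disjoint edges. For a graph $F$, a graph is $F$-free if it does not contain $F$ as a subgraph. A graph $G$ is $F$-saturated if $G$ is $F$-free, but for any edge $e$ in the complement of $G$ the graph $G+e$ contains $F$. A graph is regular if all its vertices have the same degree. $rsat(n,F)$ denotes the minimum number of edges in a regular $n$-vertex $F$-saturated graph, if such a graph exists; if there is no such graph, $rsat(n,F)$ does not exist.
   Formalization: The "otherwise" clause is stated only for n ≥ 2m+2, since for n ≤ 2m+1 the complete graph K_n is regular and vacuously (m+1)K_2-saturated, so rsat(n,(m+1)K_2) does exist there. -}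

module Defs where

open import Level using (0ℓ)
open import Data.Nat using (ℕ; _+_; _*_; _∸_; _≤_; NonZero; >-nonZero)
open import Data.Nat.Properties using (m<n⇒0<n∸m; <-≤-trans; m<m+n; 0<1+n)
open import Data.Fin using (Fin; quotient)
open import Data.Fin.Properties using (_≟_; _<?_)
open import Data.List using (length; filter; allFin; cartesianProduct)
open import Data.Product using (_×_; _,_; proj₁; proj₂; ∃-syntax)
open import Data.Sum using (_⊎_; inj₁; inj₂)
open import Function.Definitions using (Injective)
open import Relation.Binary.Core using (Rel)
open import Relation.Binary.Definitions using (Decidable; Symmetric)
open import Relation.Binary.PropositionalEquality using (_≡_; _≢_; refl; sym; trans)
open import Relation.Nullary using (¬_)
open import Relation.Nullary.Decidable using (_×-dec_; _⊎-dec_; ¬?)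

record Graph (n : ℕ) : Set₁ where
  field
    Adj     : Rel (Fin n) 0ℓ
    Adj?    : Decidable Adj
    symm    : Symmetric Adj
    irrefl  : ∀ v → ¬ Adj v v

open Graph public

degree : ∀ {n} → Graph n → Fin n → ℕ
degree {n} G v = length (filter (Adj? G v) (allFin n))

-- An edge {i , j} is counted once, as the ordered pair (i , j) with i < j.
numEdges : ∀ {n} → Graph n → ℕ
numEdges {n} G =
  length (filter (λ p → (proj₁ p <? proj₂ p) ×-dec Adj? G (proj₁ p) (proj₂ p))
                 (cartesianProduct (allFin n) (allFin n)))

Regular : ∀ {n} → Graph n → Set
Regular G = ∀ u v → degree G u ≡ degree G v

-- Subgraph containment, not necessarily induced.
Contains : ∀ {n h} → Graph n → Graph h → Set
Contains {n} {h} G F =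
  ∃[ f ] Injective {A = Fin h} {B = Fin n} _≡_ _≡_ f
       × (∀ i j → Adj F i j → Adj G (f i) (f j))

Free : ∀ {n h} → Graph h → Graph n → Set
Free F G = ¬ Contains G F

addEdge : ∀ {n} → Graph n → (u v : Fin n) → u ≢ v → Graph n
addEdge G u v u≢v = record
  { Adj    = λ i j → Adj G i j ⊎ ((i ≡ u × j ≡ v) ⊎ (i ≡ v × j ≡ u))
  ; Adj?   = λ i j → Adj? G i j ⊎-dec (((i ≟ u) ×-dec (j ≟ v)) ⊎-dec ((i ≟ v) ×-dec (j ≟ u)))
  ; symm   = λ { (inj₁ a)              → inj₁ (symm G a)
               ; (inj₂ (inj₁ (p , q))) → inj₂ (inj₂ (q , p))
               ; (inj₂ (inj₂ (p , q))) → inj₂ (inj₁ (q , p)) }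
  ; irrefl = λ { w (inj₁ a)              → irrefl G w a
               ; w (inj₂ (inj₁ (p , q))) → u≢v (trans (sym p) q)
               ; w (inj₂ (inj₂ (p , q))) → u≢v (trans (sym q) p) }
  }

Saturated : ∀ {n h} → Graph h → Graph n → Set
Saturated F G =
  Free F G × (∀ u v (u≢v : u ≢ v) → ¬ Adj G u v → Contains (addEdge G u v u≢v) F)

-- k K₂ on the vertices 0, …, 2k-1; the edges are {0,1}, {2,3}, …, {2k-2,2k-1}.
infix 8 _K₂
_K₂ : (k : ℕ) → Graph (k * 2)
k K₂ = record
  { Adj    = λ i j → i ≢ j × block i ≡ block j
  ; Adj?   = λ i j → ¬? (i ≟ j) ×-dec (block i ≟ block j)
  ; symm   = λ (p , q) → (λ e → p (sym e)) , sym q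
  ; irrefl = λ v (p , _) → p refl
  }
  where
  block : Fin (k * 2) → Fin k
  block = quotient 2

RegularSaturated : ∀ {n h} → Graph h → Graph n → Set
RegularSaturated F G = Regular G × Saturated F G

RsatExists : ∀ {h} → ℕ → Graph h → Set₁
RsatExists n F = ∃[ G ] RegularSaturated {n} F G

-- The partial function rsat as a relation: rsat(n,F) exists and equals k.
IsRsat : ∀ {h} → ℕ → Graph h → ℕ → Set₁
IsRsat n F k =
    (∃[ G ] RegularSaturated {n} F G × numEdges G ≡ k)
  × (∀ (G : Graph n) → RegularSaturated F G → k ≤ numEdges G)

n∸2m-nonZero : ∀ {n m} → 2 * m + 2 ≤ n → NonZero (n ∸ 2 * m)
n∸2m-nonZero {n} {m} h = >-nonZero (m<n⇒0<n∸m (<-≤-trans (m<m+n (2 * m) 0<1+n) h))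

{-# OPTIONS --safe #-}
module Submission where

-- Let r = n − 2m ≥ 2. A saturated graph G has no matching missing fewer than r vertices, and
-- any two distinct non-adjacent vertices are missed together by a matching missing exactly r.
-- As G is regular and not complete, every vertex has a non-neighbour, hence is missed by some
-- maximum matching, so Gallai's lemma makes "equal or adjacent" an equivalence relation: G is
-- a disjoint union of cliques, all of the same size by regularity. Their size 2t + 1 is odd,
-- since a maximum matching missing v misses nothing else in the clique of v; therefore every
-- maximum matching misses exactly one vertex per clique, and there are r cliques. This gives
-- n = r(2t + 1), m = rt and nt edges. Conversely r copies of K_{2t+1} are saturated.

open import Defs
open import Level using (Level)
open import Data.Nat using (ℕ; zero; suc; _+_; _*_; _∸_; _≤_; _<_; _/_; s≤s; NonZero; >-nonZero)
open import Data.Nat.Divisibility using (_∣_; divides; ∣⇒≤)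
open import Data.Nat.DivMod using (m*n/n≡m)
open import Data.Nat.Solver using (module +-*-Solver)
open import Data.Nat.Properties hiding (_≟_; _<?_)
open import Data.Empty using (⊥)
open import Data.Fin as Fin using (Fin; zero; suc; quotient; remainder; combine; inject≤; opposite)
open import Data.Fin.Properties as Finₚ using (_≟_; _<?_; any?; injective⇒≤; combine-remQuot; remQuot-combine; opposite-involutive)
open import Data.Fin.Permutation.Components using (transpose; transpose-inverse)
open import Data.List using (List; []; _∷_; _++_; length; filter; allFin; map; lookup; cartesianProduct)
open import Data.List.Properties using (filter-++; filter-none; filter-all; length-filter; length-++; length-tabulate)
open import Data.List.Membership.Propositional using (_∈_)
open import Data.List.Membership.Propositional.Properties using (∈-allFin; ∈-lookup; ∈-++⁻; ∈-++⁺ˡ; ∈-++⁺ʳ; ∈-filter⁺; ∈-filter⁻; ∈-cartesianProduct⁺)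
open import Data.List.Relation.Unary.All as All using ([]; _∷_)
open import Data.List.Relation.Unary.AllPairs using ([]; _∷_)
open import Data.List.Relation.Unary.Any using (here; there; index)
open import Data.List.Relation.Unary.Any.Properties using (lookup-index)
open import Data.List.Relation.Unary.Unique.Propositional using (Unique)
open import Data.List.Relation.Unary.Unique.Propositional.Properties using (allFin⁺; filter⁺; ++⁺; cartesianProduct⁺)
open import Data.Product using (_×_; _,_; proj₁; proj₂; ∃-syntax; swap)
open import Data.Sum using (_⊎_; inj₁; inj₂)
open import Data.Vec.Functional using (updateAt)
open import Data.Vec.Functional.Properties using (updateAt-updates; updateAt-minimal)
open import Function using (_∘_; id; const)
open import Relation.Binary.PropositionalEquality
open import Relation.Nullary using (¬_; yes; no; contradiction)
open import Relation.Nullary.Decidable using (_×-dec_; _⊎-dec_; ¬?; decidable-stable; dec-true)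
open import Relation.Unary using (Pred; Decidable; U)
open import Relation.Unary.Properties using (U?)

open +-*-Solver using (solve; _:=_; _:+_; _:*_; con)

private
  variable
    a b p q : Level
    A : Set a
    B : Set b
    n k : ℕ

-- Counting

lookup-injective : {xs : List A} → Unique xs → ∀ i j → lookup xs i ≡ lookup xs j → i ≡ j
lookup-injective (_ ∷ _) zero    zero    _  = refl
lookup-injective (p ∷ _) zero    (suc j) eq = contradiction eq (All.lookup p (∈-lookup j))
lookup-injective (p ∷ _) (suc i) zero    eq = contradiction (sym eq) (All.lookup p (∈-lookup i))
lookup-injective (_ ∷ u) (suc i) (suc j) eq = cong suc (lookup-injective u i j eq)

-- Pigeonhole principle: positions of `xs` are sent injectively to positions of `ys`. Most
-- comparisons of counts below rest on it.
injection⇒length≤ : {xs : List A} {ys : List B} → Unique xs → (f : A → B) →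
  (∀ {x} → x ∈ xs → f x ∈ ys) →
  (∀ {x y} → x ∈ xs → y ∈ xs → f x ≡ f y → x ≡ y) →
  length xs ≤ length ys
injection⇒length≤ {xs = xs} {ys = ys} u f f∈ f-inj = injective⇒≤ {f = g} g-injective
  where
  g : Fin (length xs) → Fin (length ys)
  g i = index (f∈ (∈-lookup i))

  g-spec : ∀ i → f (lookup xs i) ≡ lookup ys (g i)
  g-spec i = lookup-index (f∈ (∈-lookup i))

  g-injective : ∀ {i j} → g i ≡ g j → i ≡ j
  g-injective {i} {j} eq = lookup-injective u i j (f-inj (∈-lookup i) (∈-lookup j)
    (trans (g-spec i) (trans (cong (lookup ys) eq) (sym (g-spec j)))))

∈-filter⇒ : {P : Pred A p} (P? : Decidable P) (xs : List A) {x : A} → x ∈ filter P? xs → P x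
∈-filter⇒ P? xs x∈ = proj₂ (∈-filter⁻ P? {xs = xs} x∈)

filter-injection : {P : Pred A p} {Q : Pred B q} (P? : Decidable P) (Q? : Decidable Q)
  {xs : List A} {ys : List B} → Unique xs → (∀ y → y ∈ ys) → (f : A → B) →
  (∀ {x} → P x → Q (f x)) → (∀ {x y} → P x → P y → f x ≡ f y → x ≡ y) →
  length (filter P? xs) ≤ length (filter Q? ys)
filter-injection P? Q? {xs} u ∈ys f f-resp f-inj = injection⇒length≤ (filter⁺ P? u) f
  (λ x∈ → ∈-filter⁺ Q? (∈ys _) (f-resp (∈-filter⇒ P? xs x∈)))
  (λ x∈ y∈ → f-inj (∈-filter⇒ P? xs x∈) (∈-filter⇒ P? xs y∈))

filter-split : {P : Pred A p} {Q : Pred A q} (P? : Decidable P) (Q? : Decidable Q) (xs : List A) →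
  length (filter P? xs) ≡ length (filter (λ x → P? x ×-dec Q? x) xs)
                        + length (filter (λ x → P? x ×-dec ¬? (Q? x)) xs)
filter-split P? Q? [] = refl
filter-split P? Q? (x ∷ xs) with P? x | Q? x | filter-split P? Q? xs
... | no  _ | _     | ih = ih
... | yes _ | yes _ | ih = cong suc ih
... | yes _ | no  _ | ih = trans (cong suc ih) (sym (+-suc _ _))

length-filter-map : {P : Pred B p} (P? : Decidable P) (f : A → B) (xs : List A) →
  length (filter P? (map f xs)) ≡ length (filter (λ x → P? (f x)) xs)
length-filter-map P? f [] = refl
length-filter-map P? f (x ∷ xs) with P? (f x)
... | yes _ = cong suc (length-filter-map P? f xs)
... | no  _ = length-filter-map P? f xs

-- Double counting with fibres of constant size `s`. It serves the handshake lemma and later the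
-- count of vertices clique by clique.
filter-pairs : {Q : Pred A p} {R : A → Pred B q} (Q? : Decidable Q) (R? : ∀ x → Decidable (R x))
  (s : ℕ) (xs : List A) (ys : List B) →
  (∀ x → Q x → length (filter (R? x) ys) ≡ s) →
  length (filter (λ z → Q? (proj₁ z) ×-dec R? (proj₁ z) (proj₂ z)) (cartesianProduct xs ys))
    ≡ length (filter Q? xs) * s
filter-pairs Q? R? s [] ys fibre = refl
filter-pairs {Q = Q} {R = R} Q? R? s (x ∷ xs) ys fibre = begin
  length (filter QR? (map (x ,_) ys ++ cartesianProduct xs ys))
    ≡⟨ cong length (filter-++ QR? (map (x ,_) ys) _) ⟩
  length (filter QR? (map (x ,_) ys) ++ filter QR? (cartesianProduct xs ys))
    ≡⟨ length-++ (filter QR? (map (x ,_) ys)) ⟩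
  length (filter QR? (map (x ,_) ys)) + length (filter QR? (cartesianProduct xs ys))
    ≡⟨ cong₂ _+_ (length-filter-map QR? (x ,_) ys) (filter-pairs Q? R? s xs ys fibre) ⟩
  length (filter (λ y → Q? x ×-dec R? x y) ys) + length (filter Q? xs) * s
    ≡⟨ row ⟩
  length (filter Q? (x ∷ xs)) * s ∎
  where
  open ≡-Reasoning
  QR? : Decidable (λ z → Q (proj₁ z) × R (proj₁ z) (proj₂ z))
  QR? z = Q? (proj₁ z) ×-dec R? (proj₁ z) (proj₂ z)

  row-yes : Q x → ∀ zs → length (filter (λ y → Q? x ×-dec R? x y) zs) ≡ length (filter (R? x) zs)
  row-yes Qx [] = refl
  row-yes Qx (z ∷ zs) with Q? x | R? x z | row-yes Qx zs
  ... | no ¬Qx | _     | _  = contradiction Qx ¬Qx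
  ... | yes _  | yes _ | ih = cong suc ih
  ... | yes _  | no _  | ih = ih

  row : length (filter (λ y → Q? x ×-dec R? x y) ys) + length (filter Q? xs) * s
      ≡ length (filter Q? (x ∷ xs)) * s
  -- The goal now contains the decided value of `Q? x`, while `row-yes` still speaks of `Q? x`;
  -- hence the transport along `eq`.
  row with Q? x in eq
  ... | yes Qx = cong (_+ length (filter Q? xs) * s)
                  (trans (subst (λ d → length (filter (λ y → d ×-dec R? x y) ys) ≡ length (filter (R? x) ys)) eq (row-yes Qx ys)) (fibre x Qx))
  ... | no ¬Qx = cong (λ l → length l + length (filter Q? xs) * s)
                  (filter-none (λ y → no ¬Qx ×-dec R? x y) (All.universal (λ _ z → ¬Qx (proj₁ z)) ys))

-- `degree G v` unfolds to `# (Adj? G v)`, so the counting lemmas apply to degrees directly.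
# : {P : Pred (Fin n) p} → Decidable P → ℕ
# P? = length (filter P? (allFin _))

#-injection : {P : Pred (Fin n) p} {Q : Pred (Fin k) q} (P? : Decidable P) (Q? : Decidable Q) →
  (f : Fin n → Fin k) → (∀ {x} → P x → Q (f x)) →
  (∀ {x y} → P x → P y → f x ≡ f y → x ≡ y) → # P? ≤ # Q?
#-injection P? Q? = filter-injection P? Q? (allFin⁺ _) ∈-allFin

module _ {P : Pred (Fin n) p} {Q : Pred (Fin n) q} (P? : Decidable P) (Q? : Decidable Q) where

  #-mono : (∀ {x} → P x → Q x) → # P? ≤ # Q?
  #-mono P⊆Q = #-injection P? Q? id P⊆Q (λ _ _ → id)

  #-extra : (zs : List (Fin n)) → Unique zs → (∀ {z} → z ∈ zs → Q z × ¬ P z) →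
    (∀ {x} → P x → Q x) → length zs + # P? ≤ # Q?
  #-extra zs zs! zs⊆Q∖P P⊆Q =
    subst (_≤ # Q?) (length-++ zs) (injection⇒length≤ unique id ⊆Q (λ _ _ → id))
    where
    unique : Unique (zs ++ filter P? (allFin n))
    unique = ++⁺ zs! (filter⁺ P? (allFin⁺ n))
      (λ (x∈ , y∈) → proj₂ (zs⊆Q∖P x∈) (∈-filter⇒ P? (allFin n) y∈))

    ⊆Q : ∀ {x} → x ∈ zs ++ filter P? (allFin n) → x ∈ filter Q? (allFin n)
    ⊆Q x∈ with ∈-++⁻ zs x∈
    ... | inj₁ x∈ = ∈-filter⁺ Q? (∈-allFin _) (proj₁ (zs⊆Q∖P x∈))
    ... | inj₂ x∈ = ∈-filter⁺ Q? (∈-allFin _) (P⊆Q (∈-filter⇒ P? (allFin n) x∈))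

  #-cover : (zs : List (Fin n)) → (∀ {x} → P x → x ∈ zs ⊎ Q x) → # P? ≤ length zs + # Q?
  #-cover zs P⊆zs∪Q =
    subst (# P? ≤_) (length-++ zs) (injection⇒length≤ (filter⁺ P? (allFin⁺ n)) id P⊆ (λ _ _ → id))
    where
    P⊆ : ∀ {x} → x ∈ filter P? (allFin n) → x ∈ zs ++ filter Q? (allFin n)
    P⊆ x∈ with P⊆zs∪Q (∈-filter⇒ P? (allFin n) x∈)
    ... | inj₁ x∈zs = ∈-++⁺ˡ x∈zs
    ... | inj₂ Qx   = ∈-++⁺ʳ zs (∈-filter⁺ Q? (∈-allFin _) Qx)

#-cong : {P : Pred (Fin n) p} {Q : Pred (Fin n) q} (P? : Decidable P) (Q? : Decidable Q) →
  (∀ {x} → P x → Q x) → (∀ {x} → Q x → P x) → # P? ≡ # Q?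
#-cong P? Q? P⊆Q Q⊆P = ≤-antisym (#-mono P? Q? P⊆Q) (#-mono Q? P? Q⊆P)

module _ {P : Pred (Fin n) p} (P? : Decidable P) where

  #-universal : (∀ x → P x) → # P? ≡ n
  #-universal all = trans (cong length (filter-all P? (All.universal all (allFin n)))) (length-tabulate id)

  #-empty : (∀ x → ¬ P x) → # P? ≡ 0
  #-empty none = cong length (filter-none P? (All.universal none (allFin n)))

  #≤n : # P? ≤ n
  #≤n = subst (# P? ≤_) (length-tabulate id) (length-filter P? (allFin n))

  enum : Fin (# P?) → Fin n
  enum = lookup (filter P? (allFin n))

  enum-satisfies : ∀ i → P (enum i)
  enum-satisfies i = ∈-filter⇒ P? (allFin n) (∈-lookup i)

  enum-injective : ∀ i j → enum i ≡ enum j → i ≡ j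
  enum-injective = lookup-injective (filter⁺ P? (allFin⁺ n))

-- Matchings

-- A matching is given by its partner involution; the fixed points are the vertices it misses.
record Matching (G : Graph n) : Set where
  field
    partner    : Fin n → Fin n
    involutive : ∀ v → partner (partner v) ≡ v
    adjacent   : ∀ v → partner v ≢ v → Adj G v (partner v)

  Missed : Pred (Fin n) _
  Missed v = partner v ≡ v

  missed? : Decidable Missed
  missed? v = partner v ≟ v

  #missed : ℕ
  #missed = # missed?

  #edges : ℕ
  #edges = # (λ v → v <? partner v)

  partner-injective : ∀ {u v} → partner u ≡ partner v → u ≡ v
  partner-injective {u} {v} eq = trans (sym (involutive u)) (trans (cong partner eq) (involutive v))

  #-parity : {P : Pred (Fin n) p} (P? : Decidable P) → (∀ {v} → P v → P (partner v)) →
    # P? ≡ # (λ v → P? v ×-dec missed? v) + 2 * # (λ v → P? v ×-dec v <? partner v)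
  #-parity {P = P} P? closed = begin
    # P?                          ≡⟨ filter-split P? missed? (allFin n) ⟩
    # fix? + # covered?           ≡⟨ cong (# fix? +_) (filter-split covered? up? (allFin n)) ⟩
    # fix? + (# up′? + # down′?)  ≡⟨ cong (# fix? +_) (cong₂ _+_ up′≡up down′≡up) ⟩
    # fix? + (# Pup? + # Pup?)    ≡⟨ cong (λ e → # fix? + (# Pup? + e)) (sym (+-identityʳ _)) ⟩
    # fix? + 2 * # Pup?           ∎
    where
    open ≡-Reasoning
    up? : Decidable (λ v → v Fin.< partner v)
    up? v = v <? partner v
    fix? : Decidable (λ v → P v × Missed v)
    fix? v = P? v ×-dec missed? v
    covered? : Decidable (λ v → P v × ¬ Missed v)
    covered? v = P? v ×-dec ¬? (missed? v)
    up′? : Decidable (λ v → (P v × ¬ Missed v) × v Fin.< partner v)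
    up′? v = covered? v ×-dec up? v
    down′? : Decidable (λ v → (P v × ¬ Missed v) × ¬ (v Fin.< partner v))
    down′? v = covered? v ×-dec ¬? (up? v)
    Pup? : Decidable (λ v → P v × v Fin.< partner v)
    Pup? v = P? v ×-dec up? v

    up′≡up : # up′? ≡ # Pup?
    up′≡up = #-cong up′? Pup? (λ ((Pv , _) , lt) → Pv , lt)
      (λ (Pv , lt) → (Pv , λ eq → Finₚ.<-irrefl (sym eq) lt) , lt)

    -- `partner` exchanges the covered vertices of `P` above their partner with those below it, so
    -- each matched pair is counted by its smaller end.
    down′≡up : # down′? ≡ # Pup?
    down′≡up = ≤-antisym
      (#-injection down′? Pup? partner
        (λ {v} ((Pv , ¬fix) , ≮) → closed Pv ,
          subst (partner v Fin.<_) (sym (involutive v)) (Finₚ.≤∧≢⇒< (≮⇒≥ ≮) ¬fix))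
        (λ _ _ → partner-injective))
      (#-injection Pup? down′? partner
        (λ {v} (Pv , lt) → (closed Pv , λ eq → Finₚ.<-irrefl (sym (partner-injective eq)) lt) ,
          λ lt′ → <-asym lt (subst (partner v Fin.<_) (involutive v) lt′))
        (λ _ _ → partner-injective))

  #vertices : n ≡ #missed + 2 * #edges
  #vertices = begin
    n                        ≡⟨ #-universal U? _ ⟨
    # (U? {A = Fin n})       ≡⟨ #-parity U? _ ⟩
    # (λ v → U? v ×-dec missed? v) + 2 * # (λ v → U? v ×-dec v <? partner v)
      ≡⟨ cong₂ (λ x y → x + 2 * y) (#-cong _ missed? proj₂ (_ ,_))
           (#-cong _ (λ v → v <? partner v) proj₂ (_ ,_)) ⟩
    #missed + 2 * #edges     ∎
    where open ≡-Reasoning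

open Matching

restrict : {G H : Graph n} (M : Matching H) → (∀ v → partner M v ≢ v → Adj G v (partner M v)) → Matching G
restrict M adj = record { partner = partner M ; involutive = involutive M ; adjacent = adj }

-- Adding and deleting one edge of a matching

infixl 9 _[_↦_]
_[_↦_] : (Fin n → A) → Fin n → A → Fin n → A
f [ x ↦ y ] = updateAt f x (const y)

update-here : (f : Fin n → A) (x : Fin n) (y : A) → (f [ x ↦ y ]) x ≡ y
update-here f x y = updateAt-updates x f

update-there : (f : Fin n → A) {x v : Fin n} (y : A) → v ≢ x → (f [ x ↦ y ]) v ≡ f v
update-there f {x} {v} y v≢x = updateAt-minimal v x f v≢x

module _ {G : Graph n} (M : Matching G) {x y : Fin n} (xy : Adj G x y) (Mx : Missed M x) (My : Missed M y) where

  private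
    x≢y : x ≢ y
    x≢y refl = irrefl G x xy

    p′ : Fin n → Fin n
    p′ = partner M [ x ↦ y ] [ y ↦ x ]

  link-left : p′ x ≡ y
  link-left = trans (update-there _ _ x≢y) (update-here (partner M) x y)

  link-right : p′ y ≡ x
  link-right = update-here _ y x

  link-other : ∀ {v} → v ≢ x → v ≢ y → p′ v ≡ partner M v
  link-other v≢x v≢y = trans (update-there _ _ v≢y) (update-there (partner M) _ v≢x)

  link : Matching G
  link = record { partner = p′ ; involutive = inv ; adjacent = adj }
    where
    inv : ∀ v → p′ (p′ v) ≡ v
    inv v with v ≟ x | v ≟ y
    ... | yes refl | _        = trans (cong p′ link-left) link-right
    ... | no _     | yes refl = trans (cong p′ link-right) link-left
    -- Since `M` fixes `x` and `y`, the partner of any other vertex is again neither of them.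
    ... | no v≢x   | no v≢y   = trans (cong p′ (link-other v≢x v≢y))
      (trans (link-other (λ eq → v≢x (partner-injective M (trans eq (sym Mx))))
                         (λ eq → v≢y (partner-injective M (trans eq (sym My)))))
             (involutive M v))

    adj : ∀ v → p′ v ≢ v → Adj G v (p′ v)
    adj v cov with v ≟ x | v ≟ y
    ... | yes refl | _        = subst (Adj G x) (sym link-left) xy
    ... | no _     | yes refl = subst (Adj G y) (sym link-right) (symm G xy)
    ... | no v≢x   | no v≢y   = subst (Adj G v) (sym eq) (adjacent M v (cov ∘ trans eq))
      where eq = link-other v≢x v≢y

  #missed-link : 2 + #missed link ≤ #missed M
  #missed-link = #-extra (missed? link) (missed? M) (x ∷ y ∷ []) ((x≢y ∷ []) ∷ [] ∷ [])
    (λ { (here refl)         → Mx , λ eq → x≢y (trans (sym eq) link-left)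
       ; (there (here refl)) → My , λ eq → x≢y (trans (sym link-right) eq) })
    (λ {v} eq → old v eq)
    where
    old : ∀ v → Missed link v → Missed M v
    old v eq with v ≟ x | v ≟ y
    ... | yes refl | _        = Mx
    ... | no _     | yes refl = My
    ... | no v≢x   | no v≢y   = trans (sym (link-other v≢x v≢y)) eq

module _ {G : Graph n} (M : Matching G) (y : Fin n) where

  private
    z : Fin n
    z = partner M y

    p′ : Fin n → Fin n
    p′ = partner M [ y ↦ y ] [ z ↦ z ]

  unlink-right : p′ z ≡ z
  unlink-right = update-here _ z z

  unlink-left : p′ y ≡ y
  -- `y` and `z` coincide when `M` misses `y`; the deletion then changes nothing.
  unlink-left with y ≟ z
  ... | yes y≡z = subst (λ w → p′ w ≡ w) (sym y≡z) unlink-right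
  ... | no  y≢z = trans (update-there _ _ y≢z) (update-here (partner M) y y)

  unlink-other : ∀ {v} → v ≢ y → v ≢ z → p′ v ≡ partner M v
  unlink-other v≢y v≢z = trans (update-there _ _ v≢z) (update-there (partner M) _ v≢y)

  unlink : Matching G
  unlink = record { partner = p′ ; involutive = inv ; adjacent = adj }
    where
    inv : ∀ v → p′ (p′ v) ≡ v
    inv v with v ≟ y | v ≟ z
    ... | yes refl | _        = trans (cong p′ unlink-left) unlink-left
    ... | no _     | yes refl = trans (cong p′ unlink-right) unlink-right
    ... | no v≢y   | no v≢z   = trans (cong p′ (unlink-other v≢y v≢z))
      (trans (unlink-other (λ eq → v≢z (trans (sym (involutive M v)) (cong (partner M) eq)))
                           (v≢y ∘ partner-injective M))
             (involutive M v))

    adj : ∀ v → p′ v ≢ v → Adj G v (p′ v)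
    adj v cov with v ≟ y | v ≟ z
    ... | yes refl | _        = contradiction unlink-left cov
    ... | no _     | yes refl = contradiction unlink-right cov
    ... | no v≢y   | no v≢z   = subst (Adj G v) (sym eq) (adjacent M v (cov ∘ trans eq))
      where eq = unlink-other v≢y v≢z

  #missed-unlink : #missed unlink ≤ 2 + #missed M
  #missed-unlink = #-cover (missed? unlink) (missed? M) (y ∷ z ∷ []) (λ {v} eq → old v eq)
    where
    old : ∀ v → Missed unlink v → v ∈ y ∷ z ∷ [] ⊎ Missed M v
    old v eq with v ≟ y | v ≟ z
    ... | yes refl | _        = inj₁ (here refl)
    ... | no _     | yes refl = inj₁ (there (here refl))
    ... | no v≢y   | no v≢z   = inj₂ (trans (sym (unlink-other v≢y v≢z)) eq)

-- Copies of kK₂ as matchings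

quotient-remainder-injective : ∀ s {i j : Fin (k * s)} →
  quotient {k} s i ≡ quotient {k} s j → remainder {k} s i ≡ remainder {k} s j → i ≡ j
quotient-remainder-injective {k} s {i} {j} eq₁ eq₂ =
  trans (sym (combine-remQuot {k} s i)) (trans (cong₂ combine eq₁ eq₂) (combine-remQuot {k} s j))

quotient-combine : ∀ {s} (i : Fin k) (j : Fin s) → quotient {k} s (combine i j) ≡ i
quotient-combine i j = cong proj₁ (remQuot-combine i j)

remainder-combine : ∀ {s} (i : Fin k) (j : Fin s) → remainder {k} s (combine i j) ≡ j
remainder-combine {k} i j = cong proj₂ (remQuot-combine {k} i j)

opposite-≢ : (i : Fin 2) → opposite i ≢ i
opposite-≢ zero       ()
opposite-≢ (suc zero) ()

-- The perfect matching of `k K₂`: same block, other end. It is used both for copies of `k K₂` and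
-- for matching an odd clique apart from one vertex.
mate : Fin (k * 2) → Fin (k * 2)
mate {k} i = combine {k} (quotient {k} 2 i) (opposite (remainder {k} 2 i))

mate-quotient : (i : Fin (k * 2)) → quotient {k} 2 (mate {k} i) ≡ quotient {k} 2 i
mate-quotient {k} i = quotient-combine {k} _ _

mate-involutive : (i : Fin (k * 2)) → mate {k} (mate {k} i) ≡ i
mate-involutive {k} i = quotient-remainder-injective {k} 2
  (trans (mate-quotient {k} (mate {k} i)) (mate-quotient {k} i))
  (trans (remainder-combine {k} _ _)
    (trans (cong opposite (remainder-combine {k} _ _)) (opposite-involutive _)))

mate-≢ : (i : Fin (k * 2)) → mate {k} i ≢ i
mate-≢ {k} i eq = opposite-≢ _ (trans (sym (remainder-combine {k} _ _)) (cong (remainder {k} 2) eq))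

-- Block `i` goes to the `i`-th vertex lying below its partner, together with that partner.
matching⇒contains : {G : Graph n} (M : Matching G) → k ≤ #edges M → Contains G (k K₂)
matching⇒contains {n} {k} {G} M k≤e = f , f-injective , f-adj
  where
  up? : Decidable (λ v → v Fin.< partner M v)
  up? v = v <? partner M v

  v : Fin k → Fin n
  v i = enum up? (inject≤ i k≤e)

  v-up : ∀ i → v i Fin.< partner M (v i)
  v-up i = enum-satisfies up? (inject≤ i k≤e)

  v-injective : ∀ {i j} → v i ≡ v j → i ≡ j
  v-injective eq = Finₚ.inject≤-injective k≤e k≤e _ _ (enum-injective up? _ _ eq)

  pick : Fin 2 → Fin n → Fin n
  pick zero    = id
  pick (suc _) = partner M

  f : Fin (k * 2) → Fin n
  f i = pick (remainder {k} 2 i) (v (quotient {k} 2 i))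

  -- A lower end that is also the partner of a lower end would lie both below and above its own
  -- partner.
  no-clash : ∀ i j → v i ≢ partner M (v j)
  no-clash i j eq = <-asym (v-up j)
    (subst₂ Fin._<_ eq (trans (cong (partner M) eq) (involutive M _)) (v-up i))

  pick-injective : ∀ r s i j → pick r (v i) ≡ pick s (v j) → i ≡ j × r ≡ s
  pick-injective zero       zero       i j eq = v-injective eq , refl
  pick-injective zero       (suc _)    i j eq = contradiction eq (no-clash i j)
  pick-injective (suc _)    zero       i j eq = contradiction (sym eq) (no-clash j i)
  pick-injective (suc zero) (suc zero) i j eq = v-injective (partner-injective M eq) , refl

  f-injective : ∀ {i j} → f i ≡ f j → i ≡ j
  f-injective {i} {j} eq with pick-injective (remainder {k} 2 i) (remainder {k} 2 j) _ _ eq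
  ... | q≡ , r≡ = quotient-remainder-injective {k} 2 q≡ r≡

  pick-adj : ∀ r s i → r ≢ s → Adj G (pick r (v i)) (pick s (v i))
  pick-adj zero       zero       i r≢s = contradiction refl r≢s
  pick-adj zero       (suc _)    i r≢s = adjacent M _ (λ eq → Finₚ.<-irrefl (sym eq) (v-up i))
  pick-adj (suc _)    zero       i r≢s = symm G (adjacent M _ (λ eq → Finₚ.<-irrefl (sym eq) (v-up i)))
  pick-adj (suc zero) (suc zero) i r≢s = contradiction refl r≢s

  f-adj : ∀ i j → Adj (k K₂) i j → Adj G (f i) (f j)
  f-adj i j (i≢j , q≡) = subst (λ q → Adj G (f i) (pick (remainder {k} 2 j) (v q))) q≡
    (pick-adj _ _ _ (i≢j ∘ quotient-remainder-injective {k} 2 q≡))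

-- On the image of `f` the partner map is `mate` transported along `f`; elsewhere it is the
-- identity. It covers the `2k` image vertices, and the number of covered vertices is twice the
-- number of edges.
contains⇒matching : {G : Graph n} → Contains G (k K₂) → ∃[ M ] k ≤ #edges {G = G} M
contains⇒matching {n} {k} {G} (f , f-injective , f-adj) = M , k≤e
  where
  InImage : Pred (Fin n) _
  InImage v = ∃[ i ] f i ≡ v

  p′ : Fin n → Fin n
  p′ v with any? (λ i → f i ≟ v)
  ... | yes (i , _) = f (mate {k} i)
  ... | no _        = v

  p′-image : ∀ i → p′ (f i) ≡ f (mate {k} i)
  p′-image i with any? (λ j → f j ≟ f i)
  ... | yes (j , eq) = cong (f ∘ mate {k}) (f-injective eq)
  ... | no ∉         = contradiction (i , refl) ∉

  p′-other : ∀ v → ¬ InImage v → p′ v ≡ v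
  p′-other v ∉ with any? (λ j → f j ≟ v)
  ... | yes v∈ = contradiction v∈ ∉
  ... | no _   = refl

  inv : ∀ v → p′ (p′ v) ≡ v
  inv v with any? (λ i → f i ≟ v)
  ... | yes (i , refl) = trans (p′-image (mate {k} i)) (cong f (mate-involutive {k} i))
  ... | no ∉           = p′-other v ∉

  adj : ∀ v → p′ v ≢ v → Adj G v (p′ v)
  adj v cov with any? (λ i → f i ≟ v)
  ... | yes (i , refl) = f-adj i (mate {k} i) ((λ eq → mate-≢ {k} i (sym eq)) , sym (mate-quotient {k} i))
  ... | no _           = contradiction refl cov

  M : Matching G
  M = record { partner = p′ ; involutive = inv ; adjacent = adj }

  missed′? : Decidable (λ v → U v × Missed M v)
  missed′? v = U? v ×-dec missed? M v

  covered? : Decidable (λ v → U v × ¬ Missed M v)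
  covered? v = U? v ×-dec ¬? (missed? M v)

  k*2≤covered : k * 2 ≤ # covered?
  k*2≤covered = subst (_≤ # covered?) (#-universal U? _)
    (#-injection (U? {A = Fin (k * 2)}) covered? f
      (λ {i} _ → _ , λ eq → mate-≢ {k} i (f-injective (trans (sym (p′-image i)) eq)))
      (λ _ _ → f-injective))

  covered≡ : # covered? ≡ 2 * #edges M
  covered≡ = +-cancelˡ-≡ (#missed M) _ _ (begin
    #missed M + # covered?     ≡⟨ cong (_+ # covered?) (#-cong (missed? M) missed′? (_ ,_) proj₂) ⟩
    # missed′? + # covered?    ≡⟨ filter-split U? (missed? M) (allFin n) ⟨
    # (U? {A = Fin n})         ≡⟨ #-universal U? _ ⟩
    n                          ≡⟨ #vertices M ⟩
    #missed M + 2 * #edges M   ∎)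
    where open ≡-Reasoning

  k≤e : k ≤ #edges M
  k≤e = *-cancelˡ-≤ 2 (subst₂ _≤_ (*-comm k 2) covered≡ k*2≤covered)

-- Saturated graphs

-- With n = r + 2m, a matching has at most m edges if and only if it misses at least r vertices.
#edges⇔#missed : ∀ {r m f e} → r + 2 * m ≡ f + 2 * e → (r ≤ f → e ≤ m) × (e ≤ m → r ≤ f)
#edges⇔#missed {r} {m} {f} {e} eq =
  (λ r≤f → *-cancelˡ-≤ 2 (+-cancelˡ-≤ r _ _ (subst (r + 2 * e ≤_) (sym eq) (+-monoˡ-≤ (2 * e) r≤f)))) ,
  (λ e≤m → +-cancelʳ-≤ (2 * m) _ _ (subst (_≤ f + 2 * m) (sym eq) (+-monoʳ-≤ f (*-monoʳ-≤ 2 e≤m))))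

module _ {G : Graph n} {r m : ℕ} (n≡ : n ≡ r + 2 * m) where

  free⇒missed : Free (suc m K₂) G → (M : Matching G) → r ≤ #missed M
  free⇒missed free M = proj₂ (#edges⇔#missed (trans (sym n≡) (#vertices M)))
    (≮⇒≥ (λ m<e → free (matching⇒contains M m<e)))

  missed⇒free : ((M : Matching G) → r ≤ #missed M) → Free (suc m K₂) G
  missed⇒free bound copy =
    let M , m<e = contains⇒matching {k = suc m} {G = G} copy
    in  <⇒≱ m<e (proj₁ (#edges⇔#missed (trans (sym n≡) (#vertices M))) (bound M))

-- The large matching must use `uv`, for otherwise it would lie in `G`. It misses at most
-- `n - 2(m + 1) = r - 2` vertices, and deleting `uv` adds only `u` and `v` to them.
remove-added-edge : {G : Graph n} {r m : ℕ} → n ≡ r + 2 * m → Free (suc m K₂) G →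
  ∀ {u v} (u≢v : u ≢ v) (M : Matching (addEdge G u v u≢v)) → m < #edges M →
  ∃[ M′ ] #missed {G = G} M′ ≤ r × Missed M′ u × Missed M′ v
remove-added-edge {n} {G} {r} {m} n≡ free {u} {v} u≢v M m<e with partner M u ≟ v
... | no  Mu≢v = contradiction (matching⇒contains (restrict {G = G} M adj) m<e) free
  where
  adj : ∀ w → partner M w ≢ w → Adj G w (partner M w)
  adj w cov with adjacent M w cov
  ... | inj₁ a                  = a
  ... | inj₂ (inj₁ (refl , eq)) = contradiction eq Mu≢v
  ... | inj₂ (inj₂ (refl , eq)) = contradiction (trans (cong (partner M) (sym eq)) (involutive M v)) Mu≢v
... | yes Mu≡v = restrict (unlink M u) adj , missed≤ , unlink-left M u , v-missed
  where
  v-missed : Missed (unlink M u) v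
  v-missed = subst (Missed (unlink M u)) Mu≡v (unlink-right M u)

  adj : ∀ w → partner (unlink M u) w ≢ w → Adj G w (partner (unlink M u) w)
  adj w cov with adjacent (unlink M u) w cov
  ... | inj₁ a                 = a
  ... | inj₂ (inj₁ (refl , _)) = contradiction (unlink-left M u) cov
  ... | inj₂ (inj₂ (refl , _)) = contradiction v-missed cov

  missed≤ : #missed (unlink M u) ≤ r
  missed≤ = ≤-trans (#missed-unlink M u) (+-cancelʳ-≤ (2 * m) _ _ (begin
    2 + #missed M + 2 * m      ≡⟨ cong (_+ 2 * m) (+-comm 2 (#missed M)) ⟩
    #missed M + 2 + 2 * m      ≡⟨ +-assoc (#missed M) 2 (2 * m) ⟩
    #missed M + (2 + 2 * m)    ≡⟨ cong (#missed M +_) (*-suc 2 m) ⟨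
    #missed M + 2 * suc m      ≤⟨ +-monoʳ-≤ (#missed M) (*-monoʳ-≤ 2 m<e) ⟩
    #missed M + 2 * #edges M   ≡⟨ #vertices M ⟨
    n                          ≡⟨ n≡ ⟩
    r + 2 * m                  ∎))
    where open ≤-Reasoning

saturated⇒missed-pair : {G : Graph n} {r m : ℕ} → n ≡ r + 2 * m → Saturated (suc m K₂) G →
  ∀ {u v} → u ≢ v → ¬ Adj G u v → ∃[ M ] #missed {G = G} M ≤ r × Missed M u × Missed M v
saturated⇒missed-pair {G = G} {m = m} n≡ (free , sat) {u} {v} u≢v ¬uv =
  let M , m<e = contains⇒matching {k = suc m} {G = addEdge G u v u≢v} (sat u v u≢v ¬uv)
  in  remove-added-edge {G = G} n≡ free u≢v M m<e

-- Otherwise the edge `xy` could be added to `N`, leaving at most `r - 2` missed vertices.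
no-missed-edge : {G : Graph n} {r : ℕ} → ((M : Matching G) → r ≤ #missed M) →
  (N : Matching G) → #missed N ≤ r → ∀ {x y} → Adj G x y → Missed N x → ¬ Missed N y
no-missed-edge {r = r} bound N N≤r xy Nx Ny = <-irrefl refl (begin-strict
  r                               ≤⟨ bound (link N xy Nx Ny) ⟩
  #missed (link N xy Nx Ny)       <⟨ s≤s (n≤1+n _) ⟩
  2 + #missed (link N xy Nx Ny)   ≤⟨ #missed-link N xy Nx Ny ⟩
  #missed N                       ≤⟨ N≤r ⟩
  r                               ∎)
  where open ≤-Reasoning

-- Gallai's lemma: take N missing b that agrees with M as often as possible. As M misses a
-- and c while N covers both, some x ≢ b is missed by N and covered by M, and rematching x
-- with its M-partner in N yields a better N.
module Gallai {G : Graph n} {r : ℕ} (bound : (M : Matching G) → r ≤ #missed M)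
  {a b c : Fin n} (ab : Adj G a b) (bc : Adj G b c) (a≢c : a ≢ c)
  (M : Matching G) (M≤r : #missed M ≤ r) (Ma : Missed M a) (Mc : Missed M c) where

  agree? : (N : Matching G) → Decidable (λ v → partner M v ≡ partner N v)
  agree? N v = partner M v ≟ partner N v

  module _ (N : Matching G) (N≤r : #missed N ≤ r) (Nb : Missed N b) where

    Exposed : Pred (Fin n) _
    Exposed x = x ≢ b × Missed N x × ¬ Missed M x

    exposed? : Decidable Exposed
    exposed? x = ¬? (x ≟ b) ×-dec missed? N x ×-dec ¬? (missed? M x)

    ∃exposed : ∃[ x ] Exposed x
    ∃exposed with any? exposed?
    ... | yes ∃x = ∃x
    -- Without an exposed vertex, all vertices missed by `N` except `b` are among those missed by
    -- `M` except `a` and `c`, so `N` would miss at most `1 + (r - 2)` vertices.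
    ... | no  ∄x = contradiction (bound N) (<⇒≱ (begin-strict
      #missed N       ≤⟨ #-cover (missed? N) rest? (b ∷ []) cover ⟩
      1 + # rest?     <⟨ #-extra rest? (missed? M) (a ∷ c ∷ []) ((a≢c ∷ []) ∷ [] ∷ []) ac rest⊆M ⟩
      #missed M       ≤⟨ M≤r ⟩
      r               ∎))
      where
      open ≤-Reasoning
      rest? : Decidable (λ v → v ≢ b × Missed N v)
      rest? v = ¬? (v ≟ b) ×-dec missed? N v

      cover : ∀ {v} → Missed N v → v ∈ b ∷ [] ⊎ (v ≢ b × Missed N v)
      cover {v} Nv with v ≟ b
      ... | yes v≡b = inj₁ (here v≡b)
      ... | no  v≢b = inj₂ (v≢b , Nv)

      ac : ∀ {v} → v ∈ a ∷ c ∷ [] → Missed M v × ¬ (v ≢ b × Missed N v)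
      ac (here refl)         = Ma , λ (_ , Na) → no-missed-edge bound N N≤r ab Na Nb
      ac (there (here refl)) = Mc , λ (_ , Nc) → no-missed-edge bound N N≤r bc Nb Nc

      rest⊆M : ∀ {v} → v ≢ b × Missed N v → Missed M v
      rest⊆M {v} (v≢b , Nv) = decidable-stable (missed? M v) (λ ¬Mv → ∄x (v , v≢b , Nv , ¬Mv))

    improve : ∃[ N′ ] #missed N′ ≤ r × Missed N′ b × # (agree? N) < # (agree? N′)
    improve with ∃exposed
    ... | x , x≢b , Nx , ¬Mx = N′ , N′≤r , N′b , more
      where
      -- The new matching is `N - yz + xy`. Here `N` covers `y`, since otherwise `xy` would be an
      -- edge with both ends missed.
      y z : Fin n
      y = partner M x
      z = partner N y

      xy : Adj G x y
      xy = adjacent M x ¬Mx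

      ¬Ny : ¬ Missed N y
      ¬Ny = no-missed-edge bound N N≤r xy Nx

      y≢b : y ≢ b
      y≢b y≡b = ¬Ny (subst (Missed N) (sym y≡b) Nb)

      x≢z : x ≢ z
      x≢z x≡z = ¬Mx (sym (partner-injective N (trans Nx x≡z)))

      b≢z : b ≢ z
      b≢z b≡z = y≢b (sym (partner-injective N (trans Nb b≡z)))

      L : Matching G
      L = unlink N y

      Lx : Missed L x
      Lx = trans (unlink-other N y (¬Mx ∘ sym) x≢z) Nx

      Ly : Missed L y
      Ly = unlink-left N y

      N′ : Matching G
      N′ = link L xy Lx Ly

      N′≤r : #missed N′ ≤ r
      N′≤r = ≤-trans (+-cancelˡ-≤ 2 _ _ (≤-trans (#missed-link L xy Lx Ly) (#missed-unlink N y))) N≤r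

      N′-other : ∀ {v} → v ≢ x → v ≢ y → v ≢ z → partner N′ v ≡ partner N v
      N′-other v≢x v≢y v≢z = trans (link-other L xy Lx Ly v≢x v≢y) (unlink-other N y v≢y v≢z)

      N′b : Missed N′ b
      N′b = trans (N′-other (x≢b ∘ sym) (y≢b ∘ sym) b≢z) Nb

      -- `N′` differs from `N` only at `x`, `y` and `z`, and at each of these `M` and `N` disagree,
      -- so no agreement is lost; `x` is gained.
      agree-mono : ∀ {v} → partner M v ≡ partner N v → partner M v ≡ partner N′ v
      agree-mono {v} eq = trans eq (sym (N′-other v≢x v≢y v≢z))
        where
        v≢x : v ≢ x
        v≢x refl = ¬Mx (trans eq Nx)
        v≢y : v ≢ y
        v≢y refl = x≢z (trans (sym (involutive M x)) eq)
        v≢z : v ≢ z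
        v≢z refl = x≢z (sym (partner-injective M (trans eq (involutive N y))))

      more : # (agree? N) < # (agree? N′)
      more = #-extra (agree? N) (agree? N′) (x ∷ []) ([] ∷ [])
        (λ { (here refl) → sym (link-left L xy Lx Ly) , λ eq → ¬Mx (trans eq Nx) })
        agree-mono

  -- Induction on `d` replaces the choice of an `N` with maximal agreement: each improvement raises
  -- the agreement, which cannot exceed `n`.
  impossible : ∀ d (N : Matching G) → #missed N ≤ r → Missed N b → n < d + # (agree? N) → ⊥
  impossible zero    N _   _  n< = <⇒≱ n< (#≤n (agree? N))
  impossible (suc d) N N≤r Nb n< with improve N N≤r Nb
  ... | N′ , N′≤r , N′b , more = impossible d N′ N′≤r N′b
    (<-≤-trans n< (subst (_≤ d + # (agree? N′)) (+-suc d _) (+-monoʳ-≤ d more)))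

  b-not-missed : (N : Matching G) → #missed N ≤ r → ¬ Missed N b
  b-not-missed N N≤r Nb = impossible (suc n) N N≤r Nb (s≤s (m≤m+n n _))

-- Regular saturated graphs

-- Among the ordered adjacent pairs, the increasing ones are the edges and `swap` maps these
-- bijectively to the others.
handshake : (G : Graph n) (d : ℕ) → (∀ v → degree G v ≡ d) → 2 * numEdges G ≡ n * d
handshake {n} G d deg = begin
  2 * numEdges G                                                 ≡⟨ cong (numEdges G +_) (+-identityʳ _) ⟩
  numEdges G + numEdges G                                        ≡⟨ cong₂ _+_ up≡ down≡ ⟩
  length (filter up? pairs) + length (filter down? pairs)        ≡⟨ filter-split adj? less? pairs ⟨
  length (filter adj? pairs)                                     ≡⟨ filter-pairs U? (Adj? G) d (allFin n) (allFin n) (λ v _ → deg v) ⟩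
  # (U? {A = Fin n}) * d                                         ≡⟨ cong (_* d) (#-universal (U? {A = Fin n}) _) ⟩
  n * d                                                          ∎
  where
  open ≡-Reasoning
  pairs : List (Fin n × Fin n)
  pairs = cartesianProduct (allFin n) (allFin n)

  unique : Unique pairs
  unique = cartesianProduct⁺ (allFin⁺ n) (allFin⁺ n)

  complete : ∀ z → z ∈ pairs
  complete (x , y) = ∈-cartesianProduct⁺ (∈-allFin x) (∈-allFin y)

  less? : Decidable (λ (z : Fin n × Fin n) → proj₁ z Fin.< proj₂ z)
  less? z = proj₁ z <? proj₂ z

  edge? : Decidable (λ z → proj₁ z Fin.< proj₂ z × Adj G (proj₁ z) (proj₂ z))
  edge? z = less? z ×-dec Adj? G (proj₁ z) (proj₂ z)

  adj? : Decidable (λ z → U (proj₁ z) × Adj G (proj₁ z) (proj₂ z))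
  adj? z = U? (proj₁ z) ×-dec Adj? G (proj₁ z) (proj₂ z)

  up? : Decidable (λ z → (U (proj₁ z) × Adj G (proj₁ z) (proj₂ z)) × proj₁ z Fin.< proj₂ z)
  up? z = adj? z ×-dec less? z

  down? : Decidable (λ z → (U (proj₁ z) × Adj G (proj₁ z) (proj₂ z)) × ¬ (proj₁ z Fin.< proj₂ z))
  down? z = adj? z ×-dec ¬? (less? z)

  up≡ : numEdges G ≡ length (filter up? pairs)
  up≡ = ≤-antisym
    (filter-injection edge? up? unique complete id (λ (lt , uv) → (_ , uv) , lt) (λ _ _ → id))
    (filter-injection up? edge? unique complete id (λ ((_ , uv) , lt) → lt , uv) (λ _ _ → id))

  down≡ : numEdges G ≡ length (filter down? pairs)
  down≡ = ≤-antisym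
    (filter-injection edge? down? unique complete swap
      (λ (lt , uv) → (_ , symm G uv) , <-asym lt) (λ _ _ → cong swap))
    (filter-injection down? edge? unique complete swap
      (λ {z} ((_ , uv) , ≮) →
        Finₚ.≤∧≢⇒< (≮⇒≥ ≮) (λ eq → irrefl G _ (subst (λ w → Adj G w (proj₂ z)) (sym eq) uv)) , symm G uv)
      (λ _ _ → cong swap))

-- Closed neighbourhoods are used because they turn out to be the classes of an equivalence
-- relation, of size one more than the degree.
Near : Graph n → Fin n → Fin n → Set
Near G u v = u ≡ v ⊎ Adj G u v

near? : (G : Graph n) (u : Fin n) → Decidable (Near G u)
near? G u v = (u ≟ v) ⊎-dec Adj? G u v

near-sym : (G : Graph n) {u v : Fin n} → Near G u v → Near G v u
near-sym G (inj₁ eq) = inj₁ (sym eq)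
near-sym G (inj₂ uv) = inj₂ (symm G uv)

#near : (G : Graph n) (u : Fin n) → # (near? G u) ≡ suc (degree G u)
#near G u = ≤-antisym
  (#-cover (near? G u) (Adj? G u) (u ∷ []) λ { (inj₁ refl) → inj₁ (here refl) ; (inj₂ uv) → inj₂ uv })
  (#-extra (Adj? G u) (near? G u) (u ∷ []) ([] ∷ []) (λ { (here refl) → inj₁ refl , irrefl G u }) inj₂)

complete⇒contains : (G : Graph n) → k * 2 ≤ n → (∀ u v → Near G u v) → Contains G (k K₂)
complete⇒contains {k = k} G k*2≤n complete = f , f-injective , adj
  where
  f : Fin (k * 2) → Fin _
  f i = inject≤ i k*2≤n

  f-injective : ∀ {i j} → f i ≡ f j → i ≡ j
  f-injective = Finₚ.inject≤-injective k*2≤n k*2≤n _ _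

  adj : ∀ i j → Adj (k K₂) i j → Adj G (f i) (f j)
  adj i j (i≢j , _) with complete (f i) (f j)
  ... | inj₁ eq = contradiction (f-injective eq) i≢j
  ... | inj₂ uv = uv

-- Clique decomposition of a regular saturated graph

module Structure {G : Graph n} {r m : ℕ} (n≡ : n ≡ r + 2 * m) (2≤r : 2 ≤ r)
  (regular : Regular G) (saturated : Saturated (suc m K₂) G) where

  bound : (M : Matching G) → r ≤ #missed M
  bound = free⇒missed {G = G} n≡ (proj₁ saturated)

  1+m*2≤n : suc m * 2 ≤ n
  1+m*2≤n = subst (suc m * 2 ≤_) (sym n≡) (subst (λ x → 2 + x ≤ r + 2 * m) (*-comm 2 m) (+-monoˡ-≤ (2 * m) 2≤r))

  -- A complete graph on `n ≥ 2m + 2` vertices contains `m + 1` disjoint edges, so `G` is not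
  -- complete.
  far-pair : ∃[ u ] ∃[ v ] ¬ Near G u v
  far-pair with any? (λ u → any? (λ v → ¬? (near? G u v)))
  ... | yes far = far
  ... | no ¬far = contradiction
    (complete⇒contains G 1+m*2≤n (λ u v → decidable-stable (near? G u v) (λ ¬uv → ¬far (u , v , ¬uv))))
    (proj₁ saturated)

  v₀ : Fin n
  v₀ = proj₁ far-pair

  d : ℕ
  d = degree G v₀

  #near≡1+d : ∀ v → # (near? G v) ≡ suc d
  #near≡1+d v = trans (#near G v) (cong suc (regular v v₀))

  1+d<n : suc d < n
  1+d<n = subst₂ (λ x y → suc x ≤ y) (#near≡1+d v₀) (#-universal U? _)
    (#-extra (near? G v₀) U? (proj₁ (proj₂ far-pair) ∷ []) ([] ∷ [])
      (λ { (here refl) → _ , proj₂ (proj₂ far-pair) }) _)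

  -- Regularity carries the non-neighbour of `v₀` over to every `b`: all closed neighbourhoods have
  -- the same size `1 + d < n`.
  far-vertex : ∀ b → ∃[ v ] ¬ Near G b v
  far-vertex b with any? (λ v → ¬? (near? G b v))
  ... | yes far = far
  ... | no ¬far = contradiction
    (trans (sym (#near≡1+d b)) (#-universal (near? G b)
      (λ v → decidable-stable (near? G b v) (λ ¬bv → ¬far (v , ¬bv)))))
    (<⇒≢ 1+d<n)

  far⇒missed : ∀ {u v} → ¬ Near G u v → ∃[ M ] #missed {G = G} M ≤ r × Missed M u × Missed M v
  far⇒missed ¬uv = saturated⇒missed-pair {G = G} n≡ saturated (¬uv ∘ inj₁) (¬uv ∘ inj₂)

  missing : ∀ b → ∃[ M ] #missed {G = G} M ≤ r × Missed M b
  missing b = let _ , far = far-vertex b ; M , M≤r , Mb , _ = far⇒missed far in M , M≤r , Mb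

  -- If `a` and `c` were far apart, saturation would give a maximum matching missing both. By
  -- Gallai's lemma no maximum matching could then miss `b`, yet `missing b` is one.
  near-trans : ∀ {a b c} → Near G a b → Near G b c → Near G a c
  near-trans (inj₁ refl) bc = bc
  near-trans ab@(inj₂ _) (inj₁ refl) = ab
  near-trans {a} {b} {c} (inj₂ ab) (inj₂ bc) = decidable-stable (near? G a c) λ ¬ac →
    let M , M≤r , Ma , Mc = far⇒missed ¬ac
        N , N≤r , Nb      = missing b
    in  Gallai.b-not-missed bound ab bc (¬ac ∘ inj₁) M M≤r Ma Mc N N≤r Nb

  near-partner : (M : Matching G) → ∀ {u v} → Near G u v → Near G u (partner M v)
  near-partner M {u} {v} uv with partner M v ≟ v
  ... | yes eq = subst (Near G u) (sym eq) uv
  ... | no  ne = near-trans uv (inj₂ (adjacent M v ne))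

  #near-edges : Matching G → Fin n → ℕ
  #near-edges M v = # (λ w → near? G v w ×-dec w <? partner M w)

  near-parity : (M : Matching G) → ∀ v →
    suc d ≡ # (λ w → near? G v w ×-dec missed? M w) + 2 * #near-edges M v
  near-parity M v = trans (sym (#near≡1+d v)) (#-parity M (near? G v) (near-partner M))

  d-even : ∃[ t ] d ≡ 2 * t
  -- The witness is the number of edges of `M` inside the class of `v₀`. Only `v₀` is missed there,
  -- since any other missed vertex of the class would be adjacent to it.
  d-even = #near-edges M v₀ , suc-injective (trans (near-parity M v₀) (cong (_+ 2 * #near-edges M v₀) one))
    where
    M : Matching G
    M = proj₁ (missing v₀)

    v₀-missed : Missed M v₀
    v₀-missed = proj₂ (proj₂ (missing v₀))

    both? : Decidable (λ w → Near G v₀ w × Missed M w)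
    both? w = near? G v₀ w ×-dec missed? M w

    -- With the empty predicate, the general bounds for covering and for extra elements compare
    -- `both?` with the list `v₀ ∷ []` alone.
    none? : Decidable {A = Fin n} (λ _ → ⊥)
    none? _ = no id

    #none : # none? ≡ 0
    #none = #-empty none? (λ _ → id)

    only : ∀ {w} → Near G v₀ w × Missed M w → w ∈ v₀ ∷ [] ⊎ ⊥
    only (inj₁ refl , _)  = inj₁ (here refl)
    only (inj₂ uv   , Mw) = contradiction Mw (no-missed-edge bound M (proj₁ (proj₂ (missing v₀))) uv v₀-missed)

    one : # both? ≡ 1
    one = ≤-antisym
      (subst (λ x → # both? ≤ 1 + x) #none (#-cover both? none? (v₀ ∷ []) only))
      (subst (λ x → 1 + x ≤ # both?) #none
        (#-extra none? both? (v₀ ∷ []) ([] ∷ []) (λ { (here refl) → (inj₁ refl , v₀-missed) , id }) (λ ())))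

  t : ℕ
  t = proj₁ d-even

  d≡2t : d ≡ 2 * t
  d≡2t = proj₂ d-even

  -- A class is closed under `partner` and has odd size `1 + 2t`, so no matching covers all of it.
  near-missed : (M : Matching G) → ∀ v → ∃[ u ] Near G v u × Missed M u
  near-missed M v with any? (λ u → near? G v u ×-dec missed? M u)
  ... | yes ∃u = ∃u
  ... | no  ∄u = contradiction
    (sym (trans (cong suc (sym d≡2t)) (trans (near-parity M v)
      (cong (_+ 2 * #near-edges M v) (#-empty (λ u → near? G v u ×-dec missed? M u) (λ u uv → ∄u (u , uv)))))))
    (even≢odd (#near-edges M v) t)

  M₀ : Matching G
  M₀ = proj₁ (missing v₀)

  M₀≤r : #missed M₀ ≤ r
  M₀≤r = proj₁ (proj₂ (missing v₀))

  missed-near⇒≡ : ∀ {u v} → Missed M₀ u → Missed M₀ v → Near G u v → u ≡ v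
  missed-near⇒≡ Mu Mv (inj₁ eq) = eq
  missed-near⇒≡ Mu Mv (inj₂ uv) = contradiction Mv (no-missed-edge bound M₀ M₀≤r uv Mu)

  -- Pairing each vertex with the one missed vertex of its class counts the vertices classwise.
  n≡r*[1+d] : n ≡ r * suc d
  n≡r*[1+d] = begin
    n                              ≡⟨ #-universal U? _ ⟨
    # (U? {A = Fin n})             ≡⟨ ≤-antisym U≤ U≥ ⟩
    length (filter rep? pairs)     ≡⟨ filter-pairs (missed? M₀) (near? G) (suc d) (allFin n) (allFin n) (λ v _ → #near≡1+d v) ⟩
    #missed M₀ * suc d             ≡⟨ cong (_* suc d) (≤-antisym M₀≤r (bound M₀)) ⟩
    r * suc d                      ∎
    where
    open ≡-Reasoning
    pairs : List (Fin n × Fin n)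
    pairs = cartesianProduct (allFin n) (allFin n)

    rep? : Decidable (λ z → Missed M₀ (proj₁ z) × Near G (proj₁ z) (proj₂ z))
    rep? z = missed? M₀ (proj₁ z) ×-dec near? G (proj₁ z) (proj₂ z)

    U≤ : # (U? {A = Fin n}) ≤ length (filter rep? pairs)
    U≤ = filter-injection U? rep? (allFin⁺ n)
      (λ (x , y) → ∈-cartesianProduct⁺ (∈-allFin x) (∈-allFin y))
      (λ v → proj₁ (near-missed M₀ v) , v)
      (λ {v} _ → let _ , vu , Mu = near-missed M₀ v in Mu , near-sym G vu)
      (λ _ _ → cong proj₂)

    U≥ : length (filter rep? pairs) ≤ # (U? {A = Fin n})
    U≥ = filter-injection rep? U? (cartesianProduct⁺ (allFin⁺ n) (allFin⁺ n)) ∈-allFin proj₂ _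
      (λ { (Mu , uw) (Mv , vw) refl → cong (_, _) (missed-near⇒≡ Mu Mv (near-trans uw (near-sym G vw))) })

  m≡t*r : m ≡ t * r
  m≡t*r = *-cancelˡ-≡ m (t * r) 2 (+-cancelˡ-≡ r _ _ (begin
    r + 2 * m          ≡⟨ n≡ ⟨
    n                  ≡⟨ n≡r*[1+d] ⟩
    r * suc d          ≡⟨ cong (λ x → r * suc x) d≡2t ⟩
    r * suc (2 * t)    ≡⟨ solve 2 (λ r t → r :* (con 1 :+ con 2 :* t) := r :+ con 2 :* (t :* r)) refl r t ⟩
    r + 2 * (t * r)    ∎))
    where open ≡-Reasoning

  numEdges≡n*t : numEdges G ≡ n * t
  numEdges≡n*t = *-cancelˡ-≡ (numEdges G) (n * t) 2 (begin
    2 * numEdges G     ≡⟨ handshake G d (λ v → regular v v₀) ⟩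
    n * d              ≡⟨ cong (n *_) d≡2t ⟩
    n * (2 * t)        ≡⟨ solve 2 (λ n t → n :* (con 2 :* t) := con 2 :* (n :* t)) refl n t ⟩
    2 * (n * t)        ∎)
    where open ≡-Reasoning

-- Disjoint unions of odd cliques

-- Encoded in the same way as `k K₂`, which is the case `s = 2`: the cliques are the fibres of
-- `quotient`.
cliques : (q s : ℕ) → Graph (q * s)
cliques q s = record
  { Adj    = λ i j → i ≢ j × quotient {q} s i ≡ quotient {q} s j
  ; Adj?   = λ i j → ¬? (i ≟ j) ×-dec (quotient {q} s i ≟ quotient {q} s j)
  ; symm   = λ (i≢j , eq) → (i≢j ∘ sym) , sym eq
  ; irrefl = λ _ (i≢i , _) → i≢i refl
  }

#clique : ∀ q s (β : Fin q) → # (λ i → β ≟ quotient {q} s i) ≡ s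
#clique q s β = ≤-antisym
  (subst (# block? ≤_) (#-universal (U? {A = Fin s}) _)
    (#-injection block? U? (remainder {q} s) _
      (λ eq₁ eq₂ → quotient-remainder-injective {q} s (trans (sym eq₁) eq₂))))
  (subst (_≤ # block?) (#-universal (U? {A = Fin s}) _)
    (#-injection U? block? (combine β) (λ {j} _ → sym (quotient-combine β j))
      (λ {i} {j} _ _ → Finₚ.combine-injectiveʳ β i β j)))
  where
  block? : Decidable (λ i → β ≡ quotient {q} s i)
  block? i = β ≟ quotient {q} s i

cliques-degree : ∀ q s v → suc (degree (cliques q s) v) ≡ s
cliques-degree q s v = trans (sym (#near (cliques q s) v)) (trans
  (#-cong (near? (cliques q s) v) (λ w → quotient {q} s v ≟ quotient {q} s w)
    (λ { (inj₁ refl) → refl ; (inj₂ (_ , eq)) → eq }) same⇒near)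
  (#clique q s (quotient {q} s v)))
  where
  same⇒near : ∀ {w} → quotient {q} s v ≡ quotient {q} s w → Near (cliques q s) v w
  same⇒near {w} eq with v ≟ w
  ... | yes v≡w = inj₁ v≡w
  ... | no  v≢w = inj₂ (v≢w , eq)

-- Matchings of an odd clique missing one prescribed vertex

transpose-right : (i j : Fin n) → transpose i j j ≡ i
transpose-right i j with j ≟ i
... | yes j≡i = j≡i
... | no  _ rewrite dec-true (j ≟ j) refl = refl

module _ {t : ℕ} where

  private
    around-zero : Fin (suc (t * 2)) → Fin (suc (t * 2))
    around-zero zero    = zero
    around-zero (suc i) = suc (mate {t} i)

    around-zero-involutive : ∀ i → around-zero (around-zero i) ≡ i
    around-zero-involutive zero    = refl
    around-zero-involutive (suc i) = cong suc (mate-involutive {t} i)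

    around-zero-fixed : ∀ i → around-zero i ≡ i → i ≡ zero
    around-zero-fixed zero    _  = refl
    around-zero-fixed (suc i) eq = contradiction (Finₚ.suc-injective eq) (mate-≢ {t} i)

  -- `around-zero` pairs the `2t` nonzero vertices by `mate`; conjugating it with the transposition
  -- of `zero` and `h` moves its only fixed point to `h`.
  around : Fin (suc (t * 2)) → Fin (suc (t * 2)) → Fin (suc (t * 2))
  around h i = transpose h zero (around-zero (transpose zero h i))

  around-involutive : ∀ h i → around h (around h i) ≡ i
  around-involutive h i = begin
    transpose h zero (around-zero (transpose zero h (around h i)))
      ≡⟨ cong (transpose h zero ∘ around-zero) (transpose-inverse zero h {around-zero (transpose zero h i)}) ⟩
    transpose h zero (around-zero (around-zero (transpose zero h i)))
      ≡⟨ cong (transpose h zero) (around-zero-involutive (transpose zero h i)) ⟩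
    transpose h zero (transpose zero h i)
      ≡⟨ transpose-inverse h zero ⟩
    i ∎
    where open ≡-Reasoning

  around-fixes : ∀ h → around h h ≡ h
  around-fixes h = trans (cong (transpose h zero ∘ around-zero) (transpose-right zero h)) (transpose-right h zero)

  around-fixed : ∀ h i → around h i ≡ i → i ≡ h
  around-fixed h i eq = begin
    i                                      ≡⟨ transpose-inverse h zero ⟨
    transpose h zero (transpose zero h i)  ≡⟨ cong (transpose h zero) (around-zero-fixed _ fixed) ⟩
    transpose h zero zero                  ≡⟨ transpose-right h zero ⟩
    h                                      ∎
    where
    open ≡-Reasoning
    fixed : around-zero (transpose zero h i) ≡ transpose zero h i
    fixed = trans (sym (transpose-inverse zero h)) (cong (transpose zero h) eq)

-- Saturation of `q` disjoint cliques on `2t + 1` vertices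

module OddCliques (q t m : ℕ) (m≡t*q : m ≡ t * q) where

  s : ℕ
  s = suc (t * 2)

  K : Graph (q * s)
  K = cliques q s

  block : Fin (q * s) → Fin q
  block = quotient {q} s

  place : Fin (q * s) → Fin s
  place = remainder {q} s

  vertices : q * s ≡ q + 2 * m
  vertices = trans
    (solve 2 (λ q t → q :* (con 1 :+ t :* con 2) := q :+ con 2 :* (t :* q)) refl q t)
    (cong (λ x → q + 2 * x) (sym m≡t*q))

  block-partner : (M : Matching K) → ∀ i → block (partner M i) ≡ block i
  block-partner M i with partner M i ≟ i
  ... | yes eq = cong block eq
  ... | no  ne = sym (proj₂ (adjacent M i ne))

  -- Matching edges stay inside blocks, and a block has odd size, so it cannot be covered entirely.
  missed-in-block : (M : Matching K) → ∀ β → ∃[ i ] β ≡ block i × Missed M i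
  missed-in-block M β with any? (λ i → (β ≟ block i) ×-dec missed? M i)
  ... | yes ∃i = ∃i
  ... | no  ∄i = contradiction
    (sym (begin
      suc (2 * t)                 ≡⟨ cong suc (*-comm 2 t) ⟩
      s                           ≡⟨ #clique q s β ⟨
      # (λ i → β ≟ block i)       ≡⟨ #-parity M (λ i → β ≟ block i) (λ {i} eq → trans eq (sym (block-partner M i))) ⟩
      # (λ i → (β ≟ block i) ×-dec missed? M i) + 2 * half
        ≡⟨ cong (_+ 2 * half) (#-empty (λ i → (β ≟ block i) ×-dec missed? M i) (λ i → ∄i ∘ (i ,_))) ⟩
      2 * half                    ∎))
    (even≢odd half t)
    where
    open ≡-Reasoning
    half : ℕ
    half = # (λ i → (β ≟ block i) ×-dec i <? partner M i)

  free : Free (suc m K₂) K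
  -- One missed vertex chosen in each block gives `q` distinct missed vertices, and `q` is `n - 2m`
  -- here.
  free = missed⇒free {G = K} vertices λ M →
    subst (_≤ #missed M) (#-universal (U? {A = Fin q}) _)
      (#-injection U? (missed? M) (λ β → proj₁ (missed-in-block M β))
        (λ {β} _ → proj₂ (proj₂ (missed-in-block M β)))
        (λ {β} {γ} _ _ eq → trans (proj₁ (proj₂ (missed-in-block M β)))
          (trans (cong block eq) (sym (proj₁ (proj₂ (missed-in-block M γ)))))))

  module _ (hole : Fin q → Fin s) where

    private
      p′ : Fin (q * s) → Fin (q * s)
      p′ i = combine (block i) (around {t} (hole (block i)) (place i))

      block-p′ : ∀ i → block (p′ i) ≡ block i
      block-p′ i = quotient-combine _ _

      place-p′ : ∀ i → place (p′ i) ≡ around {t} (hole (block i)) (place i)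
      place-p′ i = remainder-combine {q} _ _

    -- `hole` prescribes, for each clique, the place of the single vertex to be missed.
    missing-holes : Matching K
    missing-holes = record
      { partner    = p′
      ; involutive = λ i → quotient-remainder-injective {q} s
          (trans (block-p′ (p′ i)) (block-p′ i))
          (trans (place-p′ (p′ i))
            (trans (cong₂ (λ β r → around {t} (hole β) r) (block-p′ i) (place-p′ i))
              (around-involutive {t} (hole (block i)) (place i))))
      ; adjacent   = λ i ne → (ne ∘ sym) , sym (block-p′ i)
      }

    hole-missed : ∀ i → hole (block i) ≡ place i → Missed missing-holes i
    hole-missed i eq = quotient-remainder-injective {q} s (block-p′ i)
      (trans (place-p′ i) (trans (cong (λ h → around {t} h (place i)) eq) (around-fixes {t} (place i))))

    missed-hole : ∀ i → Missed missing-holes i → place i ≡ hole (block i)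
    missed-hole i eq = around-fixed {t} (hole (block i)) (place i) (trans (sym (place-p′ i)) (cong place eq))

    #missed-holes : #missed missing-holes ≤ q
    #missed-holes = subst (#missed missing-holes ≤_) (#-universal (U? {A = Fin q}) _)
      (#-injection (missed? missing-holes) U? block _
        (λ {i} {j} fixi fixj eq → quotient-remainder-injective {q} s eq
          (trans (missed-hole i fixi) (trans (cong hole eq) (sym (missed-hole j fixj))))))

  saturated : Saturated (suc m K₂) K
  saturated = free , add
    where
    add : ∀ u v (u≢v : u ≢ v) → ¬ Adj K u v → Contains (addEdge K u v u≢v) (suc m K₂)
    add u v u≢v ¬uv = matching⇒contains {k = suc m} M (≰⇒> λ e≤m →
      <⇒≱ #missed<q (proj₂ (#edges⇔#missed (trans (sym vertices) (#vertices M))) e≤m))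
      where
      hole : Fin q → Fin s
      -- The holes are `u` and `v` in their own cliques; `zero` elsewhere is arbitrary. Being
      -- distinct and non-adjacent, `u` and `v` lie in different cliques, so the second update does
      -- not overwrite the first.
      hole = const zero [ block u ↦ place u ] [ block v ↦ place v ]

      N : Matching (addEdge K u v u≢v)
      N = restrict (missing-holes hole) (λ w → inj₁ ∘ adjacent (missing-holes hole) w)

      Nu : Missed N u
      Nu = hole-missed hole u (trans (update-there _ _ (¬uv ∘ (u≢v ,_))) (update-here (const zero) (block u) (place u)))

      Nv : Missed N v
      Nv = hole-missed hole v (update-here (const zero [ block u ↦ place u ]) _ _)

      uv : Adj (addEdge K u v u≢v) u v
      uv = inj₂ (inj₁ (refl , refl))

      -- Adding `uv` leaves at most `q - 2` missed vertices, whereas a matching with at most `m`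
      -- edges misses at least `q`.
      M : Matching (addEdge K u v u≢v)
      M = link N uv Nu Nv

      #missed<q : #missed M < q
      #missed<q = ≤-trans (n≤1+n _) (≤-trans (#missed-link N uv Nu Nv) (#missed-holes hole))

  regularSaturated : RegularSaturated (suc m K₂) K
  regularSaturated =
    (λ u v → suc-injective (trans (cliques-degree q s u) (sym (cliques-degree q s v)))) , saturated

-- The cliques live on `Fin (q * s)`, so `n` is first rewritten to `q * s`.
oddCliques-exist : ∀ {q t m} → n ≡ q + 2 * m → m ≡ t * q → RsatExists n (suc m K₂)
oddCliques-exist {q = q} {t} {m} n≡ m≡t*q
  rewrite trans n≡ (sym (OddCliques.vertices q t m m≡t*q)) = K , regularSaturated
  where open OddCliques q t m m≡t*q

-- For `n ≤ 2m + 1` the complete graph is regular, has too few vertices for `m + 1` disjoint edges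
-- and is vacuously saturated; non-existence is therefore asserted from `2m + 2` on.
theorem1 : (n m : ℕ) → 1 ≤ m →
    ((2m+2≤n : 2 * m + 2 ≤ n) → n ≤ 3 * m → (n ∸ 2 * m) ∣ m →
    IsRsat n (suc m K₂) (_/_ (n * m) (n ∸ 2 * m) {{n∸2m-nonZero {n} {m} 2m+2≤n}}))
    ×
    (2 * m + 2 ≤ n → ¬ (2 * m + 2 ≤ n × n ≤ 3 * m × (n ∸ 2 * m) ∣ m) →
    ¬ RsatExists n (suc m K₂))
theorem1 n m 1≤m = exists , not-exists
  where
  r : ℕ
  r = n ∸ 2 * m

  module _ (2m+2≤n : 2 * m + 2 ≤ n) where

    n≡ : n ≡ r + 2 * m
    n≡ = sym (m∸n+n≡m (≤-trans (m≤m+n (2 * m) 2) 2m+2≤n))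

    2≤r : 2 ≤ r
    2≤r = m+n≤o⇒m≤o∸n 2 (subst (_≤ n) (+-comm (2 * m) 2) 2m+2≤n)

    -- All regular saturated graphs on `n` vertices have the same number of edges, so any one of
    -- them attains the minimum.
    edges : (G : Graph n) → RegularSaturated (suc m K₂) G →
      numEdges G ≡ _/_ (n * m) r {{n∸2m-nonZero {n} {m} 2m+2≤n}}
    edges G (reg , sat) = begin
      numEdges G        ≡⟨ numEdges≡n*t ⟩
      n * t             ≡⟨ m*n/n≡m (n * t) r ⟨
      n * t * r / r     ≡⟨ cong (_/ r) (*-assoc n t r) ⟩
      n * (t * r) / r   ≡⟨ cong (λ x → n * x / r) m≡t*r ⟨
      n * m / r         ∎
      where
      open ≡-Reasoning
      open Structure {G = G} n≡ 2≤r reg sat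
      instance
        r≢0 : NonZero r
        r≢0 = n∸2m-nonZero {n} {m} 2m+2≤n

    exists : n ≤ 3 * m → r ∣ m →
      IsRsat n (suc m K₂) (_/_ (n * m) r {{n∸2m-nonZero {n} {m} 2m+2≤n}})
    exists _ (divides t m≡t*r) =
      let G , G-sat = oddCliques-exist {t = t} n≡ m≡t*r
      in  (G , G-sat , edges G G-sat) , λ H H-sat → ≤-reflexive (sym (edges H H-sat))

    not-exists : ¬ (2 * m + 2 ≤ n × n ≤ 3 * m × r ∣ m) → ¬ RsatExists n (suc m K₂)
    not-exists ¬cond (G , reg , sat) = ¬cond (2m+2≤n , n≤3m , r∣m)
      where
      open Structure {G = G} n≡ 2≤r reg sat
      r∣m : r ∣ m
      r∣m = divides t m≡t*r

      n≤3m : n ≤ 3 * m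
      -- As `m` is positive, `r ∣ m` gives `r ≤ m`, and `n` is `r + 2m`.
      n≤3m = subst (_≤ 3 * m) (sym n≡) (+-monoˡ-≤ (2 * m) (∣⇒≤ {{>-nonZero 1≤m}} r∣m))
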